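{- Let $d$ be a positive integer and $0\le k\le n$ integers. Then $$\det\left((-1)^{\binom{i-j}{2}}\binom{n}{k-i+j}_F\right)_{i,j=0}^{d-1}=\left\langle \begin{matrix} n\\ k\end{matrix}\right\rangle_{d,F}.$$ In particular all $\left\langle \begin{matrix} n\\ k\end{matrix}\right\rangle_{d,F}$ are positive integers.
   Context: $F_n$ are the Fibonacci numbers ($F_0=0$, $F_1=1$, $F_n=F_{n-1}+F_{n-2}$). Fibonomial coefficients: $\binom{m}{k}_F=\prod_{j=0}^{k-1}\frac{F_{m-j}}{F_{k-j}}$ for $0\le k\le m$, and $0$ if $k<0$ or $k>m$. Fibo-Hoggatt numbers: for $0\le k\le n$, $\left\langle \begin{matrix} n\\ k\end{matrix}\right\rangle_{d,F}=\prod_{j=0}^{k-1}\frac{\binom{n-j+d-1}{d}_F}{\binom{k-j+d-1}{d}_F}$. For any integer $m$, $\binom{m}{2}=m(m-1)/2$. -}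

module Defs where

open import Data.Nat as ℕ using (ℕ; zero; suc; _∸_)
open import Data.Integer as ℤ using (ℤ; +_; -[1+_])
open import Data.Fin using (Fin; zero; suc; toℕ; punchIn)
open import Data.Rational as ℚ using (ℚ; 0ℚ; 1ℚ; _÷_; ≢-nonZero)
open import Data.Rational.Properties using () renaming (_≟_ to _≟ℚ_)
open import Relation.Nullary using (yes; no)
open import Data.Bool using (true; false)
open import Data.Integer.DivMod using () renaming (_/_ to _/ℤ_)

fib : ℕ → ℕ
fib zero          = 0
fib (suc zero)    = 1
fib (suc (suc n)) = fib (suc n) ℕ.+ fib n

-- division in ℚ (only ever applied to nonzero denominators below;
-- returns 0 on a zero denominator just to make it total)
_div_ : ℚ → ℚ → ℚ
p div q with q ≟ℚ 0ℚ
... | yes _  = 0ℚ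
... | no q≢0 = _÷_ p q {{≢-nonZero q≢0}}

ℕtoℚ : ℕ → ℚ
ℕtoℚ n = (+ n) ℚ./ 1

prodℚ : ℕ → (ℕ → ℚ) → ℚ
prodℚ zero    f = 1ℚ
prodℚ (suc k) f = prodℚ k f ℚ.* f k

fibonomialℕ : ℕ → ℕ → ℚ
fibonomialℕ m k with k ℕ.≤ᵇ m
... | false = 0ℚ
... | true  = prodℚ k (λ j → ℕtoℚ (fib (m ∸ j)) div ℕtoℚ (fib (k ∸ j)))

fibonomial : ℕ → ℤ → ℚ
fibonomial m (+ k)    = fibonomialℕ m k
fibonomial m -[1+ _ ] = 0ℚ

fiboHoggatt : ℕ → ℕ → ℕ → ℚ
fiboHoggatt d n k =
  prodℚ k (λ j → fibonomialℕ (n ∸ j ℕ.+ d ∸ 1) d div fibonomialℕ (k ∸ j ℕ.+ d ∸ 1) d)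

choose2 : ℤ → ℤ
choose2 m = (m ℤ.* (m ℤ.- ℤ.1ℤ)) /ℤ (+ 2)

signPow : ℤ → ℚ
signPow t with ℤ.∣ t ∣ ℕ.% 2
... | zero  = 1ℚ
... | suc _ = ℚ.- 1ℚ

sumFin : (n : ℕ) → (Fin n → ℚ) → ℚ
sumFin zero    f = 0ℚ
sumFin (suc n) f = f zero ℚ.+ sumFin n (λ j → f (suc j))

det : (n : ℕ) → (Fin n → Fin n → ℚ) → ℚ
det zero    M = 1ℚ
det (suc n) M =
  sumFin (suc n) (λ j →
    signPow (+ toℕ j) ℚ.* M zero j ℚ.* det n (λ r c → M (suc r) (punchIn j c)))

fiboMatrix : (d n k : ℕ) → Fin d → Fin d → ℚ
fiboMatrix d n k i j =
  signPow (choose2 (+ toℕ i ℤ.- + toℕ j))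
    ℚ.* fibonomial n (+ k ℤ.- + toℕ i ℤ.+ + toℕ j)

{-# OPTIONS --safe #-}
module Submission where

-- For i ≥ 0 and all integers m, Vajda's identity gives
--   F_{m+i} C(n,m) − (−1)^i F_{n+1−m−i} C(n,m−1) = F_i C(n+1,m),
-- where C is the fibonomial coefficient. Take m = k − i + j: the coefficients, up to the
-- sign that the matrix entries carry, depend only on j, so the identity describes the
-- column operation col_j := F_{k+j} col_j + (…) col_{j−1}. Since F_0 = 0 it clears row 0
-- except for its first entry C(n,k), and the remaining minor is the matrix of size d − 1
-- for (n+1, k) with row i multiplied by F_i. The Fibo-Hoggatt numbers satisfy the same recurrence
--   (∏_{1≤j<d} F_{k+j}) X_d(n,k) = C(n,k) (∏_{1≤i<d} F_i) X_{d−1}(n+1,k).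
-- The determinant is an integer because the case i = 1 is a Pascal rule with integer
-- coefficients, and it is positive because the product is.

open import Defs
open import Data.Bool using (true; false)
open import Data.Empty using (⊥-elim)
open import Data.Fin using (Fin; zero; suc; toℕ; fromℕ<; punchIn; punchOut)
open import Data.Fin.Properties using (punchIn-injective; punchIn-punchOut; punchInᵢ≢i; toℕ-fromℕ<; toℕ<n; toℕ-injective) renaming (_≟_ to _≟F_)
open import Data.Integer as ℤ using (ℤ; -[1+_]; 1ℤ)
open import Data.Integer.DivMod using (_/ℕ_; [n/ℕd]*d≤n; n<s[n/ℕd]*d; div-pos-is-/ℕ)
import Data.Integer.Properties as ℤₚ
import Data.Integer.Tactic.RingSolver as ℤ-Solver
open import Data.Nat as ℕ using (ℕ; zero; suc; _∸_; _≤_; _<_; z≤n; s≤s)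
import Data.Nat.Properties as ℕₚ
open import Data.Product using (_×_; Σ; _,_)
open import Data.Rational as ℚ using (ℚ; 0ℚ; 1ℚ; _+_; _*_; -_; _-_; Positive; ≢-nonZero; toℚᵘ; 1/_)
open import Data.Rational.Properties using (+-*-commutativeRing; *-zeroʳ; *-identityˡ; *-identityʳ; +-identityˡ; +-identityʳ; *-assoc; *-comm; *-inverseˡ; *-cancelˡ-≤-pos; ≤-antisym; ≤-reflexive; normalize-pos; 1/pos⇒pos; pos*pos⇒pos; pos+pos⇒pos; toℚᵘ-injective; toℚᵘ-fromℚᵘ; toℚᵘ-homo-+; toℚᵘ-homo-*) renaming (_≟_ to _≟ℚ_)
open import Data.Rational.Unnormalised as ℚᵘ using (mkℚᵘ; *≡*)
import Data.Rational.Unnormalised.Properties as ℚᵘₚ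
open import Data.Sum using (inj₁; inj₂)
open import Function using (_∘_)
open import Level using (0ℓ)
open import Relation.Binary.PropositionalEquality using (_≡_; _≢_; refl; sym; trans; cong; cong₂; subst; module ≡-Reasoning)
open import Relation.Nullary using (yes; no)
open import Relation.Nullary.Decidable using (dec⇒maybe)
open import Tactic.RingSolver using (solve-∀)
import Tactic.RingSolver.Core.AlmostCommutativeRing as ACR

ring : ACR.AlmostCommutativeRing 0ℓ 0ℓ
ring = ACR.fromCommutativeRing +-*-commutativeRing (λ q → dec⇒maybe (0ℚ ≟ℚ q))

signPow-suc : ∀ n → signPow (ℤ.+ suc n) ≡ - signPow (ℤ.+ n)
signPow-suc zero          = refl
signPow-suc (suc zero)    = refl
signPow-suc (suc (suc n)) = signPow-suc n

-- Determinants

sumFin-cong : ∀ n {f g : Fin n → ℚ} → (∀ j → f j ≡ g j) → sumFin n f ≡ sumFin n g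
sumFin-cong zero    f≡g = refl
sumFin-cong (suc n) f≡g = cong₂ _+_ (f≡g zero) (sumFin-cong n (f≡g ∘ suc))

sumFin-zero : ∀ n {f : Fin n → ℚ} → (∀ j → f j ≡ 0ℚ) → sumFin n f ≡ 0ℚ
sumFin-zero zero    f≡0 = refl
sumFin-zero (suc n) f≡0 = cong₂ _+_ (f≡0 zero) (sumFin-zero n (f≡0 ∘ suc))

sumFin-linear : ∀ n x y (f g : Fin n → ℚ) →
  sumFin n (λ j → x * f j + y * g j) ≡ x * sumFin n f + y * sumFin n g
sumFin-linear zero    x y f g = nil x y
  where
  nil : ∀ x y → 0ℚ ≡ x * 0ℚ + y * 0ℚ
  nil = solve-∀ ring
sumFin-linear (suc n) x y f g =
  trans (cong (x * f zero + y * g zero +_) (sumFin-linear n x y (f ∘ suc) (g ∘ suc)))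
        (regroup x y (f zero) (g zero) (sumFin n (f ∘ suc)) (sumFin n (g ∘ suc)))
  where
  regroup : ∀ x y a b s t → x * a + y * b + (x * s + y * t) ≡ x * (a + s) + y * (b + t)
  regroup = solve-∀ ring

sumFin-scale : ∀ n x (f : Fin n → ℚ) → sumFin n (λ j → x * f j) ≡ x * sumFin n f
sumFin-scale zero    x f = sym (*-zeroʳ x)
sumFin-scale (suc n) x f =
  trans (cong (x * f zero +_) (sumFin-scale n x (f ∘ suc))) (regroup x (f zero) (sumFin n (f ∘ suc)))
  where
  regroup : ∀ x a s → x * a + x * s ≡ x * (a + s)
  regroup = solve-∀ ring

-- Only neighbouring columns are ever combined. For these the cofactor signs differ by exactly one
-- factor -1, and the inductive form follows the recursion of `punchIn`.
data Adjacent : ∀ {n} → Fin n → Fin n → Set where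
  zero : ∀ {n} → Adjacent {suc (suc n)} zero (suc zero)
  suc  : ∀ {n} {a b : Fin n} → Adjacent a b → Adjacent (suc a) (suc b)

adjacent⇒≢ : ∀ {n} {a b : Fin n} → Adjacent a b → a ≢ b
adjacent⇒≢ (suc ab) refl = adjacent⇒≢ ab refl

toℕ-adjacent : ∀ {n} {a b : Fin n} → Adjacent a b → toℕ b ≡ suc (toℕ a)
toℕ-adjacent zero     = refl
toℕ-adjacent (suc ab) = cong suc (toℕ-adjacent ab)

adjacent-fromℕ< : ∀ {n} t (t<n : t < n) (t+1<n : suc t < n) → Adjacent (fromℕ< t<n) (fromℕ< t+1<n)
adjacent-fromℕ< zero    (s≤s _) (s≤s (s≤s _)) = zero
adjacent-fromℕ< (suc t) (s≤s p) (s≤s q)       = suc (adjacent-fromℕ< t p q)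

adjacent-punchIn : ∀ {n} {a b : Fin (suc n)} → Adjacent a b → ∀ j → j ≢ a → j ≢ b →
  Σ (Fin n) λ a′ → Σ (Fin n) λ b′ → Adjacent a′ b′ × punchIn j a′ ≡ a × punchIn j b′ ≡ b
adjacent-punchIn zero zero j≢a j≢b = ⊥-elim (j≢a refl)
adjacent-punchIn zero (suc zero) j≢a j≢b = ⊥-elim (j≢b refl)
adjacent-punchIn {suc (suc n)} zero (suc (suc j)) j≢a j≢b = zero , suc zero , zero , refl , refl
adjacent-punchIn (suc {a = a} {b} ab) zero j≢a j≢b = a , b , ab , refl , refl
adjacent-punchIn {suc n} (suc ab) (suc j) j≢a j≢b
  with adjacent-punchIn ab j (j≢a ∘ cong suc) (j≢b ∘ cong suc)
... | a′ , b′ , a′b′ , eqa , eqb = suc a′ , suc b′ , suc a′b′ , cong suc eqa , cong suc eqb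

-- `punchIn a` and `punchIn b` differ at a single index, sent to `b` by the first and to `a` by the
-- second. Hence the minors at two equal adjacent columns coincide.
punchIn-adjacent : ∀ {n} {a b : Fin (suc n)} → Adjacent a b → (g : Fin (suc n) → ℚ) → g a ≡ g b →
  ∀ c → g (punchIn a c) ≡ g (punchIn b c)
punchIn-adjacent zero     g ga≡gb zero    = sym ga≡gb
punchIn-adjacent zero     g ga≡gb (suc c) = refl
punchIn-adjacent (suc ab) g ga≡gb zero    = refl
punchIn-adjacent (suc ab) g ga≡gb (suc c) = punchIn-adjacent ab (g ∘ suc) ga≡gb c

sumFin-adjacent : ∀ {n} {a b : Fin n} → Adjacent a b → (f : Fin n → ℚ) →
  (∀ j → j ≢ a → j ≢ b → f j ≡ 0ℚ) → f a + f b ≡ 0ℚ → sumFin n f ≡ 0ℚ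
sumFin-adjacent {suc (suc n)} zero f f≡0 fa+fb≡0 =
  trans (cong (λ s → f zero + (f (suc zero) + s)) (sumFin-zero n λ j → f≡0 (suc (suc j)) (λ ()) (λ ())))
        (trans (cong (f zero +_) (+-identityʳ _)) fa+fb≡0)
sumFin-adjacent {suc n} (suc ab) f f≡0 fa+fb≡0 =
  trans (cong₂ _+_ (f≡0 zero (λ ()) (λ ()))
                   (sumFin-adjacent ab (f ∘ suc) (λ j j≢a j≢b → f≡0 (suc j) (λ { refl → j≢a refl }) (λ { refl → j≢b refl })) fa+fb≡0))
        (+-identityˡ 0ℚ)

Matrix : ℕ → Set
Matrix n = Fin n → Fin n → ℚ

minor : ∀ {n} → Matrix (suc n) → Fin (suc n) → Matrix n
minor M j r c = M (suc r) (punchIn j c)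

cofactorTerm : ∀ {n} → Matrix (suc n) → Fin (suc n) → ℚ
cofactorTerm {n} M j = signPow (ℤ.+ toℕ j) * M zero j * det n (minor M j)

det-cong : ∀ n {A B : Matrix n} → (∀ i j → A i j ≡ B i j) → det n A ≡ det n B
det-cong zero    A≡B = refl
det-cong (suc n) A≡B = sumFin-cong (suc n) λ j →
  cong₂ (λ x y → signPow (ℤ.+ toℕ j) * x * y) (A≡B zero j) (det-cong n λ r c → A≡B (suc r) (punchIn j c))

-- Expansion along row 0, by induction. In the term `j = c` the combination sits in the row 0 entry
-- and the three minors agree; in every other term it sits in the minor, at column `punchOut j≢c`,
-- while the row 0 entries agree.
det-linearColumn : ∀ n (c : Fin n) x y {A B C : Matrix n} →
  (∀ i j → j ≢ c → A i j ≡ B i j) → (∀ i j → j ≢ c → A i j ≡ C i j) →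
  (∀ i → A i c ≡ x * B i c + y * C i c) →
  det n A ≡ x * det n B + y * det n C
det-linearColumn (suc n) c x y {A} {B} {C} A≡B A≡C Ac =
  trans (sumFin-cong (suc n) term) (sumFin-linear (suc n) x y (cofactorTerm B) (cofactorTerm C))
  where
  atColumn : ∀ s x y b d e → s * (x * b + y * d) * e ≡ x * (s * b * e) + y * (s * d * e)
  atColumn = solve-∀ ring
  offColumn : ∀ s x y b d e → s * b * (x * d + y * e) ≡ x * (s * b * d) + y * (s * b * e)
  offColumn = solve-∀ ring
  term : ∀ j → cofactorTerm A j ≡ x * cofactorTerm B j + y * cofactorTerm C j
  term j with j ≟F c
  ... | yes refl = begin
    s * A zero j * D A                            ≡⟨ cong (λ z → s * z * D A) (Ac zero) ⟩
    s * (x * B zero j + y * C zero j) * D A       ≡⟨ atColumn s x y _ _ _ ⟩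
    x * (s * B zero j * D A) + y * (s * C zero j * D A)
      ≡⟨ cong₂ (λ u v → x * (s * B zero j * u) + y * (s * C zero j * v))
               (det-cong n λ r i → A≡B (suc r) _ (punchInᵢ≢i j i))
               (det-cong n λ r i → A≡C (suc r) _ (punchInᵢ≢i j i)) ⟩
    x * cofactorTerm B j + y * cofactorTerm C j   ∎
    where
    open ≡-Reasoning
    s = signPow (ℤ.+ toℕ j)
    D : Matrix (suc n) → ℚ
    D M = det n (minor M j)
  ... | no j≢c = begin
    s * A zero j * D A                            ≡⟨ cong (s * A zero j *_) minors ⟩
    s * A zero j * (x * D B + y * D C)            ≡⟨ offColumn s x y _ _ _ ⟩
    x * (s * A zero j * D B) + y * (s * A zero j * D C)
      ≡⟨ cong₂ (λ u v → x * (s * u * D B) + y * (s * v * D C)) (A≡B zero j j≢c) (A≡C zero j j≢c) ⟩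
    x * cofactorTerm B j + y * cofactorTerm C j   ∎
    where
    open ≡-Reasoning
    s = signPow (ℤ.+ toℕ j)
    D : Matrix (suc n) → ℚ
    D M = det n (minor M j)
    c′ = punchOut j≢c
    moved : ∀ i → i ≢ c′ → punchIn j i ≢ c
    moved i i≢c′ eq = i≢c′ (punchIn-injective j i c′ (trans eq (sym (punchIn-punchOut j≢c))))
    minors : D A ≡ x * D B + y * D C
    minors = det-linearColumn n c′ x y
      (λ r i i≢c′ → A≡B (suc r) _ (moved i i≢c′))
      (λ r i i≢c′ → A≡C (suc r) _ (moved i i≢c′))
      (λ r → subst (λ z → A (suc r) z ≡ x * B (suc r) z + y * C (suc r) z) (sym (punchIn-punchOut j≢c)) (Ac (suc r)))

-- Deleting any other column leaves an equal adjacent pair, so those cofactor terms vanish by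
-- induction. The terms at `a` and `b` have the same minor and opposite signs.
det-equalColumns : ∀ n {a b : Fin n} (M : Matrix n) → Adjacent a b → (∀ i → M i a ≡ M i b) → det n M ≡ 0ℚ
det-equalColumns (suc n) {a} {b} M ab Ma≡Mb = sumFin-adjacent ab (cofactorTerm M) others cancel
  where
  others : ∀ j → j ≢ a → j ≢ b → cofactorTerm M j ≡ 0ℚ
  others j j≢a j≢b with adjacent-punchIn ab j j≢a j≢b
  ... | a′ , b′ , a′b′ , eqa , eqb = trans
    (cong (signPow (ℤ.+ toℕ j) * M zero j *_)
      (det-equalColumns n (minor M j) a′b′ λ r →
        trans (cong (M (suc r)) eqa) (trans (Ma≡Mb (suc r)) (cong (M (suc r)) (sym eqb)))))
    (*-zeroʳ (signPow (ℤ.+ toℕ j) * M zero j))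
  opposite : ∀ s x d → s * x * d + - s * x * d ≡ 0ℚ
  opposite = solve-∀ ring
  sign : signPow (ℤ.+ toℕ b) ≡ - signPow (ℤ.+ toℕ a)
  sign = trans (cong (signPow ∘ ℤ.+_) (toℕ-adjacent ab)) (signPow-suc (toℕ a))
  b-term : cofactorTerm M b ≡ - signPow (ℤ.+ toℕ a) * M zero a * det n (minor M a)
  b-term = trans (cong₂ (λ s x → s * x * det n (minor M b)) sign (sym (Ma≡Mb zero)))
    (cong (- signPow (ℤ.+ toℕ a) * M zero a *_)
      (det-cong n λ r c → sym (punchIn-adjacent ab (M (suc r)) (Ma≡Mb (suc r)) c)))
  cancel : cofactorTerm M a + cofactorTerm M b ≡ 0ℚ
  cancel = trans (cong (cofactorTerm M a +_) b-term) (opposite (signPow (ℤ.+ toℕ a)) (M zero a) (det n (minor M a)))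

det-addColumn : ∀ n {a b : Fin n} → Adjacent a b → ∀ x y {A B : Matrix n} →
  (∀ i j → j ≢ b → A i j ≡ B i j) → (∀ i → A i b ≡ x * B i b + y * B i a) →
  det n A ≡ x * det n B
det-addColumn n {a} {b} ab x y {A} {B} A≡B Ab = begin
  det n A                    ≡⟨ det-linearColumn n b x y A≡B
                                  (λ i j j≢b → trans (A≡B i j j≢b) (sym (C-off i j j≢b)))
                                  (λ i → trans (Ab i) (cong (λ z → x * B i b + y * z) (sym (C-at i)))) ⟩
  x * det n B + y * det n C  ≡⟨ cong (λ z → x * det n B + y * z) (det-equalColumns n C ab λ i →
                                  trans (C-off i a (adjacent⇒≢ ab)) (sym (C-at i))) ⟩
  x * det n B + y * 0ℚ       ≡⟨ dropZero (x * det n B) y ⟩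
  x * det n B                ∎
  where
  open ≡-Reasoning
  dropZero : ∀ u y → u + y * 0ℚ ≡ u
  dropZero = solve-∀ ring
  -- `B` with column `b` overwritten by column `a`: the part of `A` weighted by `y`, which has
  -- determinant 0.
  C : Matrix n
  C i j with j ≟F b
  ... | yes _ = B i a
  ... | no  _ = B i j
  C-at : ∀ i → C i b ≡ B i a
  C-at i with b ≟F b
  ... | yes _  = refl
  ... | no b≢b = ⊥-elim (b≢b refl)
  C-off : ∀ i j → j ≢ b → C i j ≡ B i j
  C-off i j j≢b with j ≟F b
  ... | yes j≡b = ⊥-elim (j≢b j≡b)
  ... | no _    = refl

-- `mixed t` takes columns 0 to `t` from `M` and the rest from `N`. Passing from `t` to `t + 1`
-- trades column `t + 1`, whose left neighbour is already a column of `M`, and costs the factor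
-- `x t`.
det-bidiagonal : ∀ e (M N : Fin (suc e) → ℕ → ℚ) (x y : ℕ → ℚ) →
  (∀ i → N i 0 ≡ M i 0) → (∀ i j → N i (suc j) ≡ x j * M i (suc j) + y j * M i j) →
  det (suc e) (λ i j → N i (toℕ j)) ≡ prodℚ e x * det (suc e) (λ i j → M i (toℕ j))
det-bidiagonal e M N x y N₀ Nₛ = begin
  det (suc e) (λ i j → N i (toℕ j)) ≡⟨ det-cong (suc e) (λ i j → sym (mixed-zero i (toℕ j))) ⟩
  D 0                               ≡⟨ steps e ℕₚ.≤-refl ⟩
  prodℚ e x * D e                   ≡⟨ cong (prodℚ e x *_) (det-cong (suc e) λ i j → mixed-≤ e i (ℕₚ.≤-pred (toℕ<n j))) ⟩
  prodℚ e x * det (suc e) (λ i j → M i (toℕ j)) ∎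
  where
  open ≡-Reasoning
  mixed : ℕ → Fin (suc e) → ℕ → ℚ
  mixed t i j with j ℕ.≤? t
  ... | yes _ = M i j
  ... | no  _ = N i j
  mixed-≤ : ∀ t i {j} → j ≤ t → mixed t i j ≡ M i j
  mixed-≤ t i {j} j≤t with j ℕ.≤? t
  ... | yes _  = refl
  ... | no j≰t = ⊥-elim (j≰t j≤t)
  mixed-> : ∀ t i {j} → t < j → mixed t i j ≡ N i j
  mixed-> t i {j} t<j with j ℕ.≤? t
  ... | yes j≤t = ⊥-elim (ℕₚ.<⇒≱ t<j j≤t)
  ... | no _    = refl
  mixed-zero : ∀ i j → mixed 0 i j ≡ N i j
  mixed-zero i zero    = trans (mixed-≤ 0 i z≤n) (sym (N₀ i))
  mixed-zero i (suc j) = mixed-> 0 i (s≤s z≤n)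
  D : ℕ → ℚ
  D t = det (suc e) (λ i j → mixed t i (toℕ j))
  mixed-suc-off : ∀ t i j → j ≢ suc t → mixed t i j ≡ mixed (suc t) i j
  mixed-suc-off t i j j≢ with ℕₚ.≤-<-connex j t
  ... | inj₁ j≤t = trans (mixed-≤ t i j≤t) (sym (mixed-≤ (suc t) i (ℕₚ.m≤n⇒m≤1+n j≤t)))
  ... | inj₂ t<j = trans (mixed-> t i t<j) (sym (mixed-> (suc t) i (ℕₚ.≤∧≢⇒< t<j (j≢ ∘ sym))))
  step : ∀ t → t < e → D t ≡ x t * D (suc t)
  step t t<e = det-addColumn (suc e) (adjacent-fromℕ< t p q) (x t) (y t)
    (λ i j j≢ → mixed-suc-off t i (toℕ j) λ eq → j≢ (toℕ-injective (trans eq (sym (toℕ-fromℕ< q)))))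
    (λ i → begin
      mixed t i (toℕ (fromℕ< q))           ≡⟨ cong (mixed t i) (toℕ-fromℕ< q) ⟩
      mixed t i (suc t)                    ≡⟨ mixed-> t i ℕₚ.≤-refl ⟩
      N i (suc t)                          ≡⟨ Nₛ i t ⟩
      x t * M i (suc t) + y t * M i t      ≡⟨ cong₂ (λ u v → x t * u + y t * v)
           (sym (trans (cong (mixed (suc t) i) (toℕ-fromℕ< q)) (mixed-≤ (suc t) i ℕₚ.≤-refl)))
           (sym (trans (cong (mixed (suc t) i) (toℕ-fromℕ< p)) (mixed-≤ (suc t) i (ℕₚ.n≤1+n t)))) ⟩
      x t * mixed (suc t) i (toℕ (fromℕ< q)) + y t * mixed (suc t) i (toℕ (fromℕ< p)) ∎)
    where
    q : suc t < suc e
    q = s≤s t<e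
    p : t < suc e
    p = ℕₚ.m<n⇒m<1+n t<e
  steps : ∀ t → t ≤ e → D 0 ≡ prodℚ t x * D t
  steps zero    _   = sym (*-identityˡ _)
  steps (suc t) t<e = begin
    D 0                           ≡⟨ steps t (ℕₚ.<⇒≤ t<e) ⟩
    prodℚ t x * D t               ≡⟨ cong (prodℚ t x *_) (step t t<e) ⟩
    prodℚ t x * (x t * D (suc t)) ≡⟨ sym (*-assoc (prodℚ t x) (x t) (D (suc t))) ⟩
    prodℚ t x * x t * D (suc t)   ∎

det-firstRow : ∀ n (M : Matrix (suc n)) → (∀ j → M zero (suc j) ≡ 0ℚ) →
  det (suc n) M ≡ M zero zero * det n (λ r c → M (suc r) (suc c))
det-firstRow n M M₀≡0 = trans
  (cong (cofactorTerm M zero +_) (sumFin-zero n λ j →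
    trans (cong (λ z → signPow (ℤ.+ toℕ (suc j)) * z * det n (minor M (suc j))) (M₀≡0 j))
          (vanish (signPow (ℤ.+ toℕ (suc j))) (det n (minor M (suc j))))))
  (onlyFirst (M zero zero) (det n (minor M zero)))
  where
  vanish : ∀ s d → s * 0ℚ * d ≡ 0ℚ
  vanish = solve-∀ ring
  onlyFirst : ∀ m d → 1ℚ * m * d + 0ℚ ≡ m * d
  onlyFirst = solve-∀ ring

-- `prodℚ` grows at its last factor, whereas row expansions and the quotient products below shed the
-- first one.
prodℚ-head : ∀ n f → prodℚ (suc n) f ≡ f 0 * prodℚ n (f ∘ suc)
prodℚ-head zero    f = *-comm 1ℚ (f 0)
prodℚ-head (suc n) f = trans (cong (_* f (suc n)) (prodℚ-head n f)) (*-assoc (f 0) _ _)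

det-scaleRows : ∀ n (r : ℕ → ℚ) (M : Matrix n) →
  det n (λ i j → r (toℕ i) * M i j) ≡ prodℚ n r * det n M
det-scaleRows zero    r M = sym (*-identityˡ 1ℚ)
det-scaleRows (suc n) r M = trans
  (sumFin-cong (suc n) λ j →
    trans (cong (signPow (ℤ.+ toℕ j) * (r 0 * M zero j) *_) (det-scaleRows n (r ∘ suc) (minor M j)))
    (trans (regroup (signPow (ℤ.+ toℕ j)) (r 0) (M zero j) (prodℚ n (r ∘ suc)) (det n (minor M j)))
           (cong (_* cofactorTerm M j) (sym (prodℚ-head n r)))))
  (sumFin-scale (suc n) (prodℚ (suc n) r) (cofactorTerm M))
  where
  regroup : ∀ s r m p d → s * (r * m) * (p * d) ≡ (r * p) * (s * m * d)
  regroup = solve-∀ ring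

-- Rational numbers

positive⇒≢0 : ∀ {q} → Positive q → q ≢ 0ℚ
positive⇒≢0 () refl

*-cancelˡ-pos : ∀ r {p q} → Positive r → r * p ≡ r * q → p ≡ q
*-cancelˡ-pos r r>0 eq = ≤-antisym
  (*-cancelˡ-≤-pos r {{r>0}} (≤-reflexive eq)) (*-cancelˡ-≤-pos r {{r>0}} (≤-reflexive (sym eq)))

*-positive : ∀ p q → Positive p → Positive q → Positive (p * q)
*-positive p q p>0 q>0 = pos*pos⇒pos p {{p>0}} q {{q>0}}

-- Positivity of the denominator excludes the branch where `div` returns the default 0.
div-*-cancel : ∀ p q → Positive q → (p div q) * q ≡ p
div-*-cancel p q q>0 with q ≟ℚ 0ℚ
... | yes q≡0 = ⊥-elim (positive⇒≢0 q>0 q≡0)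
... | no  q≢0 = trans (*-assoc p _ q)
  (trans (cong (p *_) (*-inverseˡ q {{≢-nonZero q≢0}})) (*-identityʳ p))

div-positive : ∀ p q → Positive p → Positive q → Positive (p div q)
div-positive p q p>0 q>0 with q ≟ℚ 0ℚ
... | yes q≡0 = ⊥-elim (positive⇒≢0 q>0 q≡0)
... | no  q≢0 = *-positive p ((1/ q) {{≢-nonZero q≢0}}) p>0 (1/pos⇒pos q {{q>0}})

prodℚ-positive : ∀ n f → (∀ j → j < n → Positive (f j)) → Positive (prodℚ n f)
prodℚ-positive zero    f f>0 = _
prodℚ-positive (suc n) f f>0 =
  *-positive (prodℚ n f) (f n) (prodℚ-positive n f λ j j<n → f>0 j (ℕₚ.m<n⇒m<1+n j<n)) (f>0 n ℕₚ.≤-refl)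

ℤtoℚ : ℤ → ℚ
ℤtoℚ z = z ℚ./ 1

-- `z ℚ./ 1` is normalised through a gcd and does not reduce for a variable `z`; in the unnormalised
-- rationals the claim is plain integer arithmetic.
ℤtoℚ-+ : ∀ a b → ℤtoℚ (a ℤ.+ b) ≡ ℤtoℚ a + ℤtoℚ b
ℤtoℚ-+ a b = toℚᵘ-injective (begin
  toℚᵘ (ℤtoℚ (a ℤ.+ b))                ≈⟨ toℚᵘ-fromℚᵘ (mkℚᵘ (a ℤ.+ b) 0) ⟩
  mkℚᵘ (a ℤ.+ b) 0                     ≈⟨ *≡* (cross a b) ⟩
  mkℚᵘ a 0 ℚᵘ.+ mkℚᵘ b 0               ≈⟨ ℚᵘₚ.+-cong (toℚᵘ-fromℚᵘ (mkℚᵘ a 0)) (toℚᵘ-fromℚᵘ (mkℚᵘ b 0)) ⟨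
  toℚᵘ (ℤtoℚ a) ℚᵘ.+ toℚᵘ (ℤtoℚ b)     ≈⟨ toℚᵘ-homo-+ (ℤtoℚ a) (ℤtoℚ b) ⟨
  toℚᵘ (ℤtoℚ a + ℤtoℚ b)               ∎)
  where
  open import Relation.Binary.Reasoning.Setoid ℚᵘₚ.≃-setoid
  cross : ∀ a b → (a ℤ.+ b) ℤ.* 1ℤ ≡ (a ℤ.* 1ℤ ℤ.+ b ℤ.* 1ℤ) ℤ.* 1ℤ
  cross = ℤ-Solver.solve-∀

ℤtoℚ-* : ∀ a b → ℤtoℚ (a ℤ.* b) ≡ ℤtoℚ a * ℤtoℚ b
ℤtoℚ-* a b = toℚᵘ-injective (begin
  toℚᵘ (ℤtoℚ (a ℤ.* b))                ≈⟨ toℚᵘ-fromℚᵘ (mkℚᵘ (a ℤ.* b) 0) ⟩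
  mkℚᵘ a 0 ℚᵘ.* mkℚᵘ b 0               ≈⟨ ℚᵘₚ.*-cong (toℚᵘ-fromℚᵘ (mkℚᵘ a 0)) (toℚᵘ-fromℚᵘ (mkℚᵘ b 0)) ⟨
  toℚᵘ (ℤtoℚ a) ℚᵘ.* toℚᵘ (ℤtoℚ b)     ≈⟨ toℚᵘ-homo-* (ℤtoℚ a) (ℤtoℚ b) ⟨
  toℚᵘ (ℤtoℚ a * ℤtoℚ b)               ∎)
  where
  open import Relation.Binary.Reasoning.Setoid ℚᵘₚ.≃-setoid

ℕtoℚ-positive : ∀ {n} → 0 < n → Positive (ℕtoℚ n)
ℕtoℚ-positive {suc n} _ = normalize-pos (suc n) 1

-- Fibonacci numbers with integer indices

-- F₋ₘ = (−1)ᵐ⁺¹ Fₘ, with m = n + 1 in the second clause.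
F : ℤ → ℚ
F (ℤ.+ n)  = ℕtoℚ (fib n)
F -[1+ n ] = signPow (ℤ.+ n) * ℕtoℚ (fib (suc n))

fib-positive : ∀ {n} → 0 < n → 0 < fib n
fib-positive {suc zero}    _ = s≤s z≤n
fib-positive {suc (suc n)} _ = ℕₚ.m≤n⇒m≤n+o (fib n) (fib-positive {suc n} (s≤s z≤n))

F-positive : ∀ n → Positive (F (ℤ.+ suc n))
F-positive n = ℕtoℚ-positive (fib-positive {suc n} (s≤s z≤n))

-- The clauses for -1 and -2 are those where the three indices straddle or reach 0. Further down,
-- the alternating sign turns the recurrence into F_{n+1} = F_{n+3} - F_{n+2}.
F-rec : ∀ x → F (1ℤ ℤ.+ (1ℤ ℤ.+ x)) ≡ F (1ℤ ℤ.+ x) + F x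
F-rec (ℤ.+ n)           = ℤtoℚ-+ (ℤ.+ fib (suc n)) (ℤ.+ fib n)
F-rec -[1+ zero ]       = refl
F-rec -[1+ suc zero ]   = refl
F-rec -[1+ suc (suc n) ] = trans (alternate (signPow (ℤ.+ n)) (ℕtoℚ (fib (suc n))) (ℕtoℚ (fib (suc (suc n)))))
  (cong₂ _+_ (cong (_* ℕtoℚ (fib (suc (suc n)))) (sym (signPow-suc n)))
             (cong (signPow (ℤ.+ n) *_) (sym (ℤtoℚ-+ (ℤ.+ fib (suc (suc n))) (ℤ.+ fib (suc n))))))
  where
  alternate : ∀ s a b → s * a ≡ - s * b + s * (b + a)
  alternate = solve-∀ ring

F-rec-≡ : ∀ x {y z} → y ≡ 1ℤ ℤ.+ x → z ≡ 1ℤ ℤ.+ y → F z ≡ F y + F x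
F-rec-≡ x refl refl = F-rec x

-- Both sides satisfy the Fibonacci recurrence in `m`, so the cases 0 and 1 suffice. This addition
-- formula, with `p` any integer, yields the case `i = 1` of Vajda's identity.
F-add : ∀ m p → F (ℤ.+ suc m) * F p + F (ℤ.+ m) * F (ℤ.pred p) ≡ F (ℤ.+ m ℤ.+ p)
F-add zero p = trans (base (F p) (F (ℤ.pred p))) (cong F (sym (ℤₚ.+-identityˡ p)))
  where
  base : ∀ a b → 1ℚ * a + 0ℚ * b ≡ a
  base = solve-∀ ring
F-add (suc zero) p = trans (base (F p) (F (ℤ.pred p))) (sym (F-rec-≡ (ℤ.pred p) (shift p) refl))
  where
  base : ∀ a b → 1ℚ * a + 1ℚ * b ≡ a + b
  base = solve-∀ ring
  shift : ∀ p → p ≡ 1ℤ ℤ.+ (ℤ.- 1ℤ ℤ.+ p)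
  shift = ℤ-Solver.solve-∀
F-add (suc (suc m)) p = begin
  F (ℤ.+ (3 ℕ.+ m)) * F p + F (ℤ.+ (2 ℕ.+ m)) * F (ℤ.pred p)
    ≡⟨ cong₂ (λ u v → u * F p + v * F (ℤ.pred p)) (F-rec (ℤ.+ suc m)) (F-rec (ℤ.+ m)) ⟩
  (F (ℤ.+ (2 ℕ.+ m)) + F (ℤ.+ (1 ℕ.+ m))) * F p + (F (ℤ.+ (1 ℕ.+ m)) + F (ℤ.+ m)) * F (ℤ.pred p)
    ≡⟨ regroup (F (ℤ.+ (2 ℕ.+ m))) (F (ℤ.+ (1 ℕ.+ m))) (F (ℤ.+ m)) (F p) (F (ℤ.pred p)) ⟩
  _ ≡⟨ cong₂ _+_ (F-add (suc m) p) (F-add m p) ⟩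
  F (ℤ.+ suc m ℤ.+ p) + F (ℤ.+ m ℤ.+ p)
    ≡⟨ sym (F-rec-≡ (ℤ.+ m ℤ.+ p) (ℤₚ.+-assoc 1ℤ (ℤ.+ m) p) (ℤₚ.+-assoc 1ℤ (ℤ.+ suc m) p)) ⟩
  F (ℤ.+ suc (suc m) ℤ.+ p) ∎
  where
  open ≡-Reasoning
  regroup : ∀ a b c u v → (a + b) * u + (b + c) * v ≡ (a * u + b * v) + (b * u + c * v)
  regroup = solve-∀ ring

-- Vajda's identity. Both terms on the left satisfy the Fibonacci recurrence in i.
F-vajda : ∀ m N i →
  F (ℤ.+ m ℤ.+ ℤ.+ i) * F (N ℤ.- ℤ.+ m) - signPow (ℤ.+ i) * F (N ℤ.- (ℤ.+ m ℤ.+ ℤ.+ i)) * F (ℤ.+ m) ≡ F (ℤ.+ i) * F N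
F-vajda m N zero = begin
  F (ℤ.+ m ℤ.+ ℤ.+ 0) * F (N ℤ.- ℤ.+ m) - 1ℚ * F (N ℤ.- (ℤ.+ m ℤ.+ ℤ.+ 0)) * F (ℤ.+ m)
    ≡⟨ cong (λ z → F z * F (N ℤ.- ℤ.+ m) - 1ℚ * F (N ℤ.- z) * F (ℤ.+ m)) (ℤₚ.+-identityʳ (ℤ.+ m)) ⟩
  F (ℤ.+ m) * F (N ℤ.- ℤ.+ m) - 1ℚ * F (N ℤ.- ℤ.+ m) * F (ℤ.+ m)
    ≡⟨ cancel (F (ℤ.+ m)) (F (N ℤ.- ℤ.+ m)) (F N) ⟩
  0ℚ * F N ∎
  where
  open ≡-Reasoning
  cancel : ∀ a b c → a * b - 1ℚ * b * a ≡ 0ℚ * c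
  cancel = solve-∀ ring
F-vajda m N (suc zero) = begin
  F (ℤ.+ m ℤ.+ 1ℤ) * F p - - 1ℚ * F (N ℤ.- (ℤ.+ m ℤ.+ 1ℤ)) * F (ℤ.+ m)
    ≡⟨ cong₂ (λ u v → F u * F p - - 1ℚ * F v * F (ℤ.+ m)) (ℤₚ.+-comm (ℤ.+ m) 1ℤ) (shift N (ℤ.+ m)) ⟩
  F (ℤ.+ suc m) * F p - - 1ℚ * F (ℤ.pred p) * F (ℤ.+ m)
    ≡⟨ regroup (F (ℤ.+ suc m)) (F p) (F (ℤ.pred p)) (F (ℤ.+ m)) ⟩
  F (ℤ.+ suc m) * F p + F (ℤ.+ m) * F (ℤ.pred p) ≡⟨ F-add m p ⟩
  F (ℤ.+ m ℤ.+ p)                                ≡⟨ cong F (total N (ℤ.+ m)) ⟩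
  F N                                            ≡⟨ sym (*-identityˡ (F N)) ⟩
  1ℚ * F N                                       ∎
  where
  open ≡-Reasoning
  p = N ℤ.- ℤ.+ m
  shift : ∀ N m → N ℤ.- (m ℤ.+ 1ℤ) ≡ ℤ.- 1ℤ ℤ.+ (N ℤ.- m)
  shift = ℤ-Solver.solve-∀
  total : ∀ N m → m ℤ.+ (N ℤ.- m) ≡ N
  total = ℤ-Solver.solve-∀
  regroup : ∀ a b c d → a * b - - 1ℚ * c * d ≡ a * b + d * c
  regroup = solve-∀ ring
F-vajda m N (suc (suc i)) = begin
  F (up 2) * F p - s * F (down 2) * F (ℤ.+ m)
    ≡⟨ cong₂ (λ u v → u * F p - s * v * F (ℤ.+ m)) (F-rec-≡ (up 0) (raise (ℤ.+ m) (ℤ.+ i)) (raise (ℤ.+ m) (ℤ.+ suc i))) lower ⟩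
  (F (up 1) + F (up 0)) * F p - s * (F (down 0) - F (down 1)) * F (ℤ.+ m)
    ≡⟨ regroup (F (up 1)) (F (up 0)) (F p) s (F (down 0)) (F (down 1)) (F (ℤ.+ m)) ⟩
  (F (up 1) * F p - - s * F (down 1) * F (ℤ.+ m)) + (F (up 0) * F p - s * F (down 0) * F (ℤ.+ m))
    ≡⟨ cong₂ _+_ (trans (cong (λ z → F (up 1) * F p - z * F (down 1) * F (ℤ.+ m)) (sym (signPow-suc i)))
                        (F-vajda m N (suc i)))
                 (F-vajda m N i) ⟩
  F (ℤ.+ suc i) * F N + F (ℤ.+ i) * F N    ≡⟨ collect (F (ℤ.+ suc i)) (F (ℤ.+ i)) (F N) ⟩
  (F (ℤ.+ suc i) + F (ℤ.+ i)) * F N        ≡⟨ cong (_* F N) (sym (F-rec (ℤ.+ i))) ⟩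
  F (ℤ.+ suc (suc i)) * F N                ∎
  where
  open ≡-Reasoning
  p = N ℤ.- ℤ.+ m
  s = signPow (ℤ.+ i)
  up down : ℕ → ℤ
  up t = ℤ.+ m ℤ.+ ℤ.+ (t ℕ.+ i)
  down t = N ℤ.- up t
  raise : ∀ m i → m ℤ.+ (1ℤ ℤ.+ i) ≡ 1ℤ ℤ.+ (m ℤ.+ i)
  raise = ℤ-Solver.solve-∀
  drop : ∀ N m i → N ℤ.- (m ℤ.+ i) ≡ 1ℤ ℤ.+ (N ℤ.- (m ℤ.+ (1ℤ ℤ.+ i)))
  drop = ℤ-Solver.solve-∀
  difference : ∀ a b → a ≡ b + a - b
  difference = solve-∀ ring
  -- Read downwards, the recurrence gives a difference; its minus sign is the one that (-1)^i
  -- acquires between `i` and `i + 1`.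
  lower : F (down 2) ≡ F (down 0) - F (down 1)
  lower = trans (difference (F (down 2)) (F (down 1)))
    (cong (_- F (down 1)) (sym (F-rec-≡ (down 2) (drop N (ℤ.+ m) (ℤ.+ suc i)) (drop N (ℤ.+ m) (ℤ.+ i)))))
  regroup : ∀ a b p s c d m → (a + b) * p - s * (c - d) * m ≡ (a * p - - s * d * m) + (b * p - s * c * m)
  regroup = solve-∀ ring
  collect : ∀ a b c → a * c + b * c ≡ (a + b) * c
  collect = solve-∀ ring

-- Fibonomial coefficients

-- The first factor of the left product is F_{m+1}/F_{k+1}; the others are those of
-- `fibonomialℕ m k`, since `suc m ∸ suc j` reduces to `m ∸ j`.
fibonomialℕ-suc : ∀ m k →
  F (ℤ.+ suc k) * fibonomialℕ (suc m) (suc k) ≡ F (ℤ.+ suc m) * fibonomialℕ m k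
fibonomialℕ-suc m k = absorb k
  where
  quotient : ℕ → ℕ → ℕ → ℚ
  quotient m k j = ℕtoℚ (fib (m ∸ j)) div ℕtoℚ (fib (k ∸ j))
  product : ∀ k → F (ℤ.+ suc k) * prodℚ (suc k) (quotient (suc m) (suc k)) ≡ F (ℤ.+ suc m) * prodℚ k (quotient m k)
  product k = begin
    F (ℤ.+ suc k) * prodℚ (suc k) (quotient (suc m) (suc k))  ≡⟨ cong (F (ℤ.+ suc k) *_) (prodℚ-head k (quotient (suc m) (suc k))) ⟩
    F (ℤ.+ suc k) * (first * rest)                            ≡⟨ regroup (F (ℤ.+ suc k)) first rest ⟩
    first * F (ℤ.+ suc k) * rest                              ≡⟨ cong (_* rest) (div-*-cancel (F (ℤ.+ suc m)) (F (ℤ.+ suc k)) (F-positive k)) ⟩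
    F (ℤ.+ suc m) * rest                                      ∎
    where
    open ≡-Reasoning
    first = F (ℤ.+ suc m) div F (ℤ.+ suc k)
    rest  = prodℚ k (quotient m k)
    regroup : ∀ a b c → a * (b * c) ≡ b * a * c
    regroup = solve-∀ ring
  absorb : ∀ k → F (ℤ.+ suc k) * fibonomialℕ (suc m) (suc k) ≡ F (ℤ.+ suc m) * fibonomialℕ m k
  absorb zero = product zero
  absorb (suc k) with k ℕ.<ᵇ m
  ... | true  = product (suc k)
  ... | false = trans (*-zeroʳ (F (ℤ.+ suc (suc k)))) (sym (*-zeroʳ (F (ℤ.+ suc m))))

fibonomialℕ-positive : ∀ {m k} → k ≤ m → Positive (fibonomialℕ m k)
fibonomialℕ-positive {m} {k} k≤m with k ℕ.≤ᵇ m | ℕₚ.≤⇒≤ᵇ k≤m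
... | true | _ = prodℚ-positive k _ λ j j<k →
  div-positive (ℕtoℚ (fib (m ∸ j))) (ℕtoℚ (fib (k ∸ j)))
    (ℕtoℚ-positive (fib-positive (ℕₚ.m<n⇒0<n∸m (ℕₚ.<-≤-trans j<k k≤m))))
    (ℕtoℚ-positive (fib-positive (ℕₚ.m<n⇒0<n∸m j<k)))

-- Absorption extended to integers: at `m = 0` the factor F_0 matches the zero coefficient at -1,
-- and below that both coefficients are 0.
fibonomial-lower : ∀ n m → F m * fibonomial (suc n) m ≡ F (ℤ.+ suc n) * fibonomial n (ℤ.pred m)
fibonomial-lower n (ℤ.+ zero)  = sym (*-zeroʳ (F (ℤ.+ suc n)))
fibonomial-lower n (ℤ.+ suc k) = fibonomialℕ-suc n k
fibonomial-lower n -[1+ k ]    = trans (*-zeroʳ (F -[1+ k ])) (sym (*-zeroʳ (F (ℤ.+ suc n))))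

-- Induction along the diagonal: after multiplication by F_{k+1}, absorption lowers `n` and `k`
-- together. With the difference taken in ℤ, the left side vanishes at `k = n + 1` through F_0 and
-- beyond that through the coefficient.
fibonomialℕ-upper : ∀ n k →
  F (ℤ.+ suc n ℤ.- ℤ.+ k) * fibonomialℕ (suc n) k ≡ F (ℤ.+ suc n) * fibonomialℕ n k
fibonomialℕ-upper n       zero       = cong (λ z → F z * 1ℚ) (ℤₚ.+-identityʳ (ℤ.+ suc n))
fibonomialℕ-upper zero    (suc zero) = refl
fibonomialℕ-upper zero    (suc (suc k)) = trans (*-zeroʳ (F (1ℤ ℤ.- ℤ.+ suc (suc k)))) (sym (*-zeroʳ 1ℚ))
fibonomialℕ-upper (suc n) (suc k) = *-cancelˡ-pos (F (ℤ.+ suc k)) (F-positive k) (begin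
  F (ℤ.+ suc k) * (F (ℤ.+ suc (suc n) ℤ.- ℤ.+ suc k) * fibonomialℕ (suc (suc n)) (suc k))
    ≡⟨ swap (F (ℤ.+ suc k)) (F (ℤ.+ suc (suc n) ℤ.- ℤ.+ suc k)) (fibonomialℕ (suc (suc n)) (suc k)) ⟩
  F (ℤ.+ suc (suc n) ℤ.- ℤ.+ suc k) * (F (ℤ.+ suc k) * fibonomialℕ (suc (suc n)) (suc k))
    ≡⟨ cong₂ (λ z w → F z * w) (shift (ℤ.+ suc n) (ℤ.+ k)) (fibonomialℕ-suc (suc n) k) ⟩
  F (ℤ.+ suc n ℤ.- ℤ.+ k) * (F (ℤ.+ suc (suc n)) * fibonomialℕ (suc n) k)
    ≡⟨ swap (F (ℤ.+ suc n ℤ.- ℤ.+ k)) (F (ℤ.+ suc (suc n))) (fibonomialℕ (suc n) k) ⟩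
  F (ℤ.+ suc (suc n)) * (F (ℤ.+ suc n ℤ.- ℤ.+ k) * fibonomialℕ (suc n) k)
    ≡⟨ cong (F (ℤ.+ suc (suc n)) *_) (trans (fibonomialℕ-upper n k) (sym (fibonomialℕ-suc n k))) ⟩
  F (ℤ.+ suc (suc n)) * (F (ℤ.+ suc k) * fibonomialℕ (suc n) (suc k))
    ≡⟨ swap (F (ℤ.+ suc (suc n))) (F (ℤ.+ suc k)) (fibonomialℕ (suc n) (suc k)) ⟩
  F (ℤ.+ suc k) * (F (ℤ.+ suc (suc n)) * fibonomialℕ (suc n) (suc k)) ∎)
  where
  open ≡-Reasoning
  swap : ∀ a b c → a * (b * c) ≡ b * (a * c)
  swap = solve-∀ ring
  shift : ∀ n k → (1ℤ ℤ.+ n) ℤ.- (1ℤ ℤ.+ k) ≡ n ℤ.- k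
  shift = ℤ-Solver.solve-∀

-- For i = 1 this is the Pascal recurrence of the fibonomials.
fibonomial-vajda : ∀ n i m →
  F (m ℤ.+ ℤ.+ i) * fibonomial n m - signPow (ℤ.+ i) * F (ℤ.+ suc n ℤ.- (m ℤ.+ ℤ.+ i)) * fibonomial n (ℤ.pred m)
    ≡ F (ℤ.+ i) * fibonomial (suc n) m
fibonomial-vajda n i -[1+ k ] = zeros (F (-[1+ k ] ℤ.+ ℤ.+ i)) (signPow (ℤ.+ i)) (F (ℤ.+ suc n ℤ.- (-[1+ k ] ℤ.+ ℤ.+ i))) (F (ℤ.+ i))
  where
  zeros : ∀ a b c d → a * 0ℚ - b * c * 0ℚ ≡ d * 0ℚ
  zeros = solve-∀ ring
-- After multiplication by F_{n+1} both coefficients become multiples of C(n+1, m), and what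
-- multiplies C(n+1, m) is the left side of Vajda's identity at N = n + 1.
fibonomial-vajda n i (ℤ.+ k) = *-cancelˡ-pos (F (ℤ.+ suc n)) (F-positive n) (begin
  F N * (u * fibonomial n m - s * v * fibonomial n (ℤ.pred m))
    ≡⟨ distribute (F N) u (fibonomial n m) s v (fibonomial n (ℤ.pred m)) ⟩
  u * (F N * fibonomial n m) - s * v * (F N * fibonomial n (ℤ.pred m))
    ≡⟨ cong₂ (λ x y → u * x - s * v * y) (sym (fibonomialℕ-upper n k)) (sym (fibonomial-lower n m)) ⟩
  u * (F (N ℤ.- m) * b) - s * v * (F m * b)
    ≡⟨ collect u (F (N ℤ.- m)) b s v (F m) ⟩
  (u * F (N ℤ.- m) - s * v * F m) * b
    ≡⟨ cong (_* b) (F-vajda k N i) ⟩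
  F (ℤ.+ i) * F N * b
    ≡⟨ swap (F (ℤ.+ i)) (F N) b ⟩
  F N * (F (ℤ.+ i) * b) ∎)
  where
  open ≡-Reasoning
  m = ℤ.+ k
  N = ℤ.+ suc n
  u = F (m ℤ.+ ℤ.+ i)
  v = F (N ℤ.- (m ℤ.+ ℤ.+ i))
  s = signPow (ℤ.+ i)
  b = fibonomial (suc n) m
  distribute : ∀ f u x s v y → f * (u * x - s * v * y) ≡ u * (f * x) - s * v * (f * y)
  distribute = solve-∀ ring
  collect : ∀ u p b s v q → u * (p * b) - s * v * (q * b) ≡ (u * p - s * v * q) * b
  collect = solve-∀ ring
  swap : ∀ a b c → a * b * c ≡ b * (a * c)
  swap = solve-∀ ring

-- Signs

neg-neg : ∀ q → q ≡ - - q
neg-neg = solve-∀ ring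

signPow-step : ∀ x → signPow (1ℤ ℤ.+ x) ≡ - signPow x
signPow-step (ℤ.+ n)      = signPow-suc n
signPow-step -[1+ zero ]  = refl
-- `signPow` sees only the absolute value, which here drops from `n + 2` to `n + 1`.
signPow-step -[1+ suc n ] = trans (neg-neg (signPow (ℤ.+ suc n))) (cong -_ (sym (signPow-suc (suc n))))

signPow-+ : ∀ x y → signPow (x ℤ.+ y) ≡ signPow x * signPow y
signPow-+ (ℤ.+ zero) y = trans (cong signPow (ℤₚ.+-identityˡ y)) (sym (*-identityˡ (signPow y)))
signPow-+ (ℤ.+ suc n) y = begin
  signPow (ℤ.+ suc n ℤ.+ y)         ≡⟨ cong signPow (ℤₚ.+-assoc 1ℤ (ℤ.+ n) y) ⟩
  signPow (1ℤ ℤ.+ (ℤ.+ n ℤ.+ y))    ≡⟨ signPow-step (ℤ.+ n ℤ.+ y) ⟩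
  - signPow (ℤ.+ n ℤ.+ y)           ≡⟨ cong -_ (signPow-+ (ℤ.+ n) y) ⟩
  - (signPow (ℤ.+ n) * signPow y)   ≡⟨ negˡ (signPow (ℤ.+ n)) (signPow y) ⟩
  - signPow (ℤ.+ n) * signPow y     ≡⟨ cong (_* signPow y) (sym (signPow-suc n)) ⟩
  signPow (ℤ.+ suc n) * signPow y   ∎
  where
  open ≡-Reasoning
  negˡ : ∀ a b → - (a * b) ≡ - a * b
  negˡ = solve-∀ ring
signPow-+ -[1+ zero ] y = begin
  signPow (-[1+ 0 ] ℤ.+ y)              ≡⟨ neg-neg (signPow (-[1+ 0 ] ℤ.+ y)) ⟩
  - - signPow (-[1+ 0 ] ℤ.+ y)          ≡⟨ cong -_ (sym (signPow-step (-[1+ 0 ] ℤ.+ y))) ⟩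
  - signPow (1ℤ ℤ.+ (-[1+ 0 ] ℤ.+ y))   ≡⟨ cong (-_ ∘ signPow) (ℤₚ.suc-pred y) ⟩
  - signPow y                           ≡⟨ neg (signPow y) ⟩
  - 1ℚ * signPow y                      ∎
  where
  open ≡-Reasoning
  neg : ∀ a → - a ≡ - 1ℚ * a
  neg = solve-∀ ring
signPow-+ -[1+ suc n ] y = begin
  signPow (-[1+ suc n ] ℤ.+ y)              ≡⟨ neg-neg (signPow (-[1+ suc n ] ℤ.+ y)) ⟩
  - - signPow (-[1+ suc n ] ℤ.+ y)          ≡⟨ cong -_ (sym (signPow-step (-[1+ suc n ] ℤ.+ y))) ⟩
  - signPow (1ℤ ℤ.+ (-[1+ suc n ] ℤ.+ y))   ≡⟨ cong (-_ ∘ signPow) (sym (ℤₚ.+-assoc 1ℤ -[1+ suc n ] y)) ⟩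
  - signPow (-[1+ n ] ℤ.+ y)                ≡⟨ cong -_ (signPow-+ -[1+ n ] y) ⟩
  - (signPow -[1+ n ] * signPow y)          ≡⟨ negˡ (signPow -[1+ n ]) (signPow y) ⟩
  - signPow -[1+ n ] * signPow y            ≡⟨ cong (_* signPow y) (sym (signPow-suc (suc n))) ⟩
  signPow -[1+ suc n ] * signPow y          ∎
  where
  open ≡-Reasoning
  negˡ : ∀ a b → - (a * b) ≡ - a * b
  negˡ = solve-∀ ring

-- Two candidates for the floor bound each other: the lower bound of one and the upper bound of the
-- other give a d < (b + 1) d, hence a ≤ b, in both directions.
/ℕ-unique : ∀ n d .{{_ : ℕ.NonZero d}} q → q ℤ.* ℤ.+ d ℤ.≤ n → n ℤ.< ℤ.suc q ℤ.* ℤ.+ d → n /ℕ d ≡ q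
/ℕ-unique n d q qd≤n n<sqd = ℤₚ.≤-antisym
  (below (n /ℕ d) q (ℤₚ.≤-<-trans ([n/ℕd]*d≤n n d) n<sqd))
  (below q (n /ℕ d) (ℤₚ.≤-<-trans qd≤n (n<s[n/ℕd]*d n d)))
  where
  below : ∀ a b → a ℤ.* ℤ.+ d ℤ.< ℤ.suc b ℤ.* ℤ.+ d → a ℤ.≤ b
  below a b lt = subst (a ℤ.≤_) (ℤₚ.pred-suc b) (ℤₚ.i<j⇒i≤pred[j] (ℤₚ.*-cancelʳ-<-nonNeg {a} {ℤ.suc b} (ℤ.+ d) lt))

+*-/ℕ : ∀ a m d .{{_ : ℕ.NonZero d}} → (a ℤ.+ m ℤ.* ℤ.+ d) /ℕ d ≡ a /ℕ d ℤ.+ m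
+*-/ℕ a m d = /ℕ-unique (a ℤ.+ m ℤ.* ℤ.+ d) d (a /ℕ d ℤ.+ m)
  (subst (ℤ._≤ a ℤ.+ m ℤ.* ℤ.+ d) (sym (ℤₚ.*-distribʳ-+ (ℤ.+ d) (a /ℕ d) m)) (ℤₚ.+-monoˡ-≤ (m ℤ.* ℤ.+ d) ([n/ℕd]*d≤n a d)))
  (subst (a ℤ.+ m ℤ.* ℤ.+ d ℤ.<_) (expand (a /ℕ d) m (ℤ.+ d)) (ℤₚ.+-monoˡ-< (m ℤ.* ℤ.+ d) (n<s[n/ℕd]*d a d)))
  where
  expand : ∀ q m d → (1ℤ ℤ.+ q) ℤ.* d ℤ.+ m ℤ.* d ≡ (1ℤ ℤ.+ (q ℤ.+ m)) ℤ.* d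
  expand = ℤ-Solver.solve-∀

-- The numerator m(m - 1) grows by 2m, a multiple of the divisor, which passes out of the floor
-- division. Negative `m` is covered, as entries with i < j require.
choose2-step : ∀ m → choose2 (1ℤ ℤ.+ m) ≡ choose2 m ℤ.+ m
choose2-step m = begin
  choose2 (1ℤ ℤ.+ m)                         ≡⟨ div-pos-is-/ℕ ((1ℤ ℤ.+ m) ℤ.* (1ℤ ℤ.+ m ℤ.- 1ℤ)) 2 ⟩
  ((1ℤ ℤ.+ m) ℤ.* (1ℤ ℤ.+ m ℤ.- 1ℤ)) /ℕ 2    ≡⟨ cong (_/ℕ 2) (expand m) ⟩
  (m ℤ.* (m ℤ.- 1ℤ) ℤ.+ m ℤ.* ℤ.+ 2) /ℕ 2    ≡⟨ +*-/ℕ (m ℤ.* (m ℤ.- 1ℤ)) m 2 ⟩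
  (m ℤ.* (m ℤ.- 1ℤ)) /ℕ 2 ℤ.+ m              ≡⟨ cong (ℤ._+ m) (sym (div-pos-is-/ℕ (m ℤ.* (m ℤ.- 1ℤ)) 2)) ⟩
  choose2 m ℤ.+ m                            ∎
  where
  open ≡-Reasoning
  expand : ∀ m → (1ℤ ℤ.+ m) ℤ.* (1ℤ ℤ.+ m ℤ.- 1ℤ) ≡ m ℤ.* (m ℤ.- 1ℤ) ℤ.+ m ℤ.* ℤ.+ 2
  expand = ℤ-Solver.solve-∀

ε : ℤ → ℚ
ε = signPow ∘ choose2

-- This lets the sign pattern of the matrix absorb an alternating factor: with m = i - j - 1, moving
-- from column j + 1 to column j multiplies the sign by (-1)^m.
ε-step : ∀ m → ε (1ℤ ℤ.+ m) ≡ ε m * signPow m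
ε-step m = trans (cong signPow (choose2-step m)) (signPow-+ (choose2 m) m)

-- Recurrences in d

det-fiboMatrix-rec : ∀ d n k →
  prodℚ d (λ j → F (ℤ.+ k ℤ.+ ℤ.+ suc j)) * det (suc d) (fiboMatrix (suc d) n k)
    ≡ fibonomialℕ n k * (prodℚ d (λ i → F (ℤ.+ suc i)) * det d (fiboMatrix d (suc n) k))
det-fiboMatrix-rec d n k = begin
  prodℚ d x * det (suc d) (fiboMatrix (suc d) n k)
    ≡⟨ sym (det-bidiagonal d (M ∘ toℕ) (N ∘ toℕ) x y (λ i → refl) (λ i → column (toℕ i))) ⟩
  det (suc d) (λ i j → N (toℕ i) (toℕ j))
    -- Row 0 of `N` carries the factor F_0 = 0 outside column 0.
    ≡⟨ det-firstRow d (λ i j → N (toℕ i) (toℕ j)) (λ j → vanish (e 0 (toℕ j)) (fibonomial (suc n) (index 0 (suc (toℕ j))))) ⟩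
  1ℚ * fibonomial n (ℤ.+ k ℤ.+ ℤ.+ 0 ℤ.+ ℤ.+ 0) * det d (λ i j → N (suc (toℕ i)) (suc (toℕ j)))
    ≡⟨ cong₂ _*_ corner (det-cong d entry) ⟩
  fibonomialℕ n k * det d (λ i j → F (ℤ.+ suc (toℕ i)) * fiboMatrix d (suc n) k i j)
    ≡⟨ cong (fibonomialℕ n k *_) (det-scaleRows d (λ i → F (ℤ.+ suc i)) (fiboMatrix d (suc n) k)) ⟩
  fibonomialℕ n k * (prodℚ d (λ i → F (ℤ.+ suc i)) * det d (fiboMatrix d (suc n) k)) ∎
  where
  open ≡-Reasoning
  x y : ℕ → ℚ
  x j = F (ℤ.+ k ℤ.+ ℤ.+ suc j)
  y j = - (signPow (ℤ.+ suc j) * F (ℤ.+ suc n ℤ.- (ℤ.+ k ℤ.+ ℤ.+ suc j)))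
  index : ℕ → ℕ → ℤ
  index i j = ℤ.+ k ℤ.- ℤ.+ i ℤ.+ ℤ.+ j
  e : ℕ → ℕ → ℚ
  e i j = ε (ℤ.+ i ℤ.- ℤ.+ suc j)
  M N : ℕ → ℕ → ℚ
  M i j = ε (ℤ.+ i ℤ.- ℤ.+ j) * fibonomial n (index i j)
  -- Column 0 is kept; column j + 1 holds, up to sign, the right-hand side of `fibonomial-vajda` at
  -- m = k - i + j + 1.
  N i zero    = M i 0
  N i (suc j) = e i j * (F (ℤ.+ i) * fibonomial (suc n) (index i (suc j)))

  column : ∀ i j → N i (suc j) ≡ x j * M i (suc j) + y j * M i j
  column i j = begin
    e i j * (F (ℤ.+ i) * fibonomial (suc n) m)
      ≡⟨ cong (e i j *_) (sym (fibonomial-vajda n i m)) ⟩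
    e i j * (F (m ℤ.+ ℤ.+ i) * b - signPow (ℤ.+ i) * F (ℤ.+ suc n ℤ.- (m ℤ.+ ℤ.+ i)) * fibonomial n (ℤ.pred m))
      ≡⟨ cong₂ (λ u z → e i j * (F u * b - signPow (ℤ.+ i) * F (ℤ.+ suc n ℤ.- u) * fibonomial n z))
               (m+i (ℤ.+ k) (ℤ.+ i) (ℤ.+ suc j)) (m-1 (ℤ.+ k) (ℤ.+ i) (ℤ.+ j)) ⟩
    e i j * (x j * b - signPow (ℤ.+ i) * v * b′)
      -- (-1)^i splits as (-1)^(j+1) times (-1)^(i-j-1). The first goes into `y j`, which must not
      -- depend on `i`; the second turns the sign of column j + 1 into that of column j.
      ≡⟨ cong (λ s → e i j * (x j * b - s * v * b′)) sign ⟩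
    e i j * (x j * b - s * t * v * b′)
      ≡⟨ regroup (e i j) (x j) b s t v b′ ⟩
    x j * (e i j * b) + - (s * v) * (e i j * t * b′)
      ≡⟨ cong (λ u → x j * (e i j * b) + y j * (u * b′))
              (sym (trans (cong ε (next (ℤ.+ i) (ℤ.+ j))) (ε-step (ℤ.+ i ℤ.- ℤ.+ suc j)))) ⟩
    x j * M i (suc j) + y j * M i j ∎
    where
    m = index i (suc j)
    b = fibonomial n m
    b′ = fibonomial n (index i j)
    v = F (ℤ.+ suc n ℤ.- (ℤ.+ k ℤ.+ ℤ.+ suc j))
    s = signPow (ℤ.+ suc j)
    t = signPow (ℤ.+ i ℤ.- ℤ.+ suc j)
    m+i : ∀ k i j → k ℤ.- i ℤ.+ j ℤ.+ i ≡ k ℤ.+ j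
    m+i = ℤ-Solver.solve-∀
    m-1 : ∀ k i j → ℤ.- 1ℤ ℤ.+ (k ℤ.- i ℤ.+ (1ℤ ℤ.+ j)) ≡ k ℤ.- i ℤ.+ j
    m-1 = ℤ-Solver.solve-∀
    next : ∀ i j → i ℤ.- j ≡ 1ℤ ℤ.+ (i ℤ.- (1ℤ ℤ.+ j))
    next = ℤ-Solver.solve-∀
    total : ∀ i j → i ≡ j ℤ.+ (i ℤ.- j)
    total = ℤ-Solver.solve-∀
    sign : signPow (ℤ.+ i) ≡ s * t
    sign = trans (cong signPow (total (ℤ.+ i) (ℤ.+ suc j))) (signPow-+ (ℤ.+ suc j) (ℤ.+ i ℤ.- ℤ.+ suc j))
    regroup : ∀ e x b s t v b′ → e * (x * b - s * t * v * b′) ≡ x * (e * b) + - (s * v) * (e * t * b′)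
    regroup = solve-∀ ring

  vanish : ∀ e b → e * (0ℚ * b) ≡ 0ℚ
  vanish = solve-∀ ring

  corner : 1ℚ * fibonomial n (ℤ.+ k ℤ.+ ℤ.+ 0 ℤ.+ ℤ.+ 0) ≡ fibonomialℕ n k
  corner = trans (*-identityˡ _)
    (cong (fibonomial n) (trans (ℤₚ.+-identityʳ (ℤ.+ k ℤ.+ ℤ.+ 0)) (ℤₚ.+-identityʳ (ℤ.+ k))))

  -- Raising both indices by one changes neither i - j nor k - i + j.
  entry : ∀ i j → N (suc (toℕ i)) (suc (toℕ j)) ≡ F (ℤ.+ suc (toℕ i)) * fiboMatrix d (suc n) k i j
  entry i j = begin
    ε (ℤ.+ suc (toℕ i) ℤ.- ℤ.+ suc (toℕ j)) * (f * fibonomial (suc n) (index (suc (toℕ i)) (suc (toℕ j))))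
      ≡⟨ cong₂ (λ u v → ε u * (f * fibonomial (suc n) v))
               (shift (ℤ.+ toℕ i) (ℤ.+ toℕ j)) (shift-index (ℤ.+ k) (ℤ.+ toℕ i) (ℤ.+ toℕ j)) ⟩
    ε (ℤ.+ toℕ i ℤ.- ℤ.+ toℕ j) * (f * fibonomial (suc n) (index (toℕ i) (toℕ j)))
      ≡⟨ swap (ε (ℤ.+ toℕ i ℤ.- ℤ.+ toℕ j)) f (fibonomial (suc n) (index (toℕ i) (toℕ j))) ⟩
    f * fiboMatrix d (suc n) k i j ∎
    where
    f = F (ℤ.+ suc (toℕ i))
    shift : ∀ i j → (1ℤ ℤ.+ i) ℤ.- (1ℤ ℤ.+ j) ≡ i ℤ.- j
    shift = ℤ-Solver.solve-∀
    shift-index : ∀ k i j → k ℤ.- (1ℤ ℤ.+ i) ℤ.+ (1ℤ ℤ.+ j) ≡ k ℤ.- i ℤ.+ j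
    shift-index = ℤ-Solver.solve-∀
    swap : ∀ a b c → a * (b * c) ≡ b * (a * c)
    swap = solve-∀ ring

fiboHoggatt-suc : ∀ d n k →
  fiboHoggatt d (suc n) (suc k) ≡ (fibonomialℕ (n ℕ.+ d) d div fibonomialℕ (k ℕ.+ d) d) * fiboHoggatt d n k
fiboHoggatt-suc d n k =
  prodℚ-head k (λ j → fibonomialℕ (suc n ∸ j ℕ.+ d ∸ 1) d div fibonomialℕ (suc k ∸ j ℕ.+ d ∸ 1) d)

-- Induction on `k`, lowering `n` with it, at fixed `d`: each Hoggatt number sheds its first
-- quotient. The factor F_{k+1} C(k+d, d) clears both denominators, directly on the right, and on
-- the left because `slide` supplies F_{k+d+1} and F_{k+d+1} C(k+d, d) = F_{d+1} C(k+d+1, d+1).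
fiboHoggatt-rec : ∀ d {k n} → k ≤ n →
  prodℚ d (λ j → F (ℤ.+ k ℤ.+ ℤ.+ suc j)) * fiboHoggatt (suc d) n k
    ≡ fibonomialℕ n k * (prodℚ d (λ i → F (ℤ.+ suc i)) * fiboHoggatt d (suc n) k)
-- For `k = 0` the two Fibonacci products coincide and both Hoggatt numbers are empty products.
fiboHoggatt-rec d z≤n = sym (*-identityˡ (prodℚ d (λ i → F (ℤ.+ suc i)) * 1ℚ))
fiboHoggatt-rec d {suc k} {suc n} (s≤s k≤n) = *-cancelˡ-pos (fk * C′) (*-positive fk C′ (F-positive k) (fibonomialℕ-positive {k ℕ.+ d} {d} (ℕₚ.m≤n+m d k))) (begin
  fk * C′ * (R (suc k) d * fiboHoggatt (suc d) (suc n) (suc k))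
    ≡⟨ cong (λ h → fk * C′ * (R (suc k) d * h)) (fiboHoggatt-suc (suc d) n k) ⟩
  fk * C′ * (R (suc k) d * ((A div A′) * H))
    ≡⟨ isolate fk C′ (R (suc k) d) (A div A′) H ⟩
  fk * R (suc k) d * C′ * (A div A′) * H
    ≡⟨ cong (λ r → r * C′ * (A div A′) * H) (slide d) ⟩
  R k d * F (ℤ.+ k ℤ.+ ℤ.+ suc d) * C′ * (A div A′) * H
    ≡⟨ isolate′ (R k d) (F (ℤ.+ k ℤ.+ ℤ.+ suc d)) C′ (A div A′) H ⟩
  F (ℤ.+ k ℤ.+ ℤ.+ suc d) * C′ * (A div A′) * (R k d * H)
    ≡⟨ cong (λ u → u * (A div A′) * (R k d * H)) (sym (fd*A′ k)) ⟩
  fd * A′ * (A div A′) * (R k d * H)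
    ≡⟨ reassoc fd A′ (A div A′) (R k d * H) ⟩
  fd * ((A div A′) * A′) * (R k d * H)
    ≡⟨ cong₂ (λ u v → fd * u * v) (div-*-cancel A A′ (fibonomialℕ-positive {k ℕ.+ suc d} {suc d} (ℕₚ.m≤n+m (suc d) k))) (fiboHoggatt-rec d k≤n) ⟩
  fd * A * (B * (P * G))
    ≡⟨ cong (_* (B * (P * G))) fd*A ⟩
  fn * C * (B * (P * G))
    ≡⟨ cong (λ u → fn * u * (B * (P * G))) (sym (div-*-cancel C C′ (fibonomialℕ-positive {k ℕ.+ d} {d} (ℕₚ.m≤n+m d k)))) ⟩
  fn * ((C div C′) * C′) * (B * (P * G))
    ≡⟨ collect fn (C div C′) C′ B P G ⟩
  fn * B * (C′ * (P * ((C div C′) * G)))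
    ≡⟨ cong (_* (C′ * (P * ((C div C′) * G)))) (sym (fibonomialℕ-suc n k)) ⟩
  fk * fibonomialℕ (suc n) (suc k) * (C′ * (P * ((C div C′) * G)))
    ≡⟨ swap fk (fibonomialℕ (suc n) (suc k)) C′ (P * ((C div C′) * G)) ⟩
  fk * C′ * (fibonomialℕ (suc n) (suc k) * (P * ((C div C′) * G)))
    ≡⟨ cong (λ g → fk * C′ * (fibonomialℕ (suc n) (suc k) * (P * g))) (sym (fiboHoggatt-suc d (suc n) k)) ⟩
  fk * C′ * (fibonomialℕ (suc n) (suc k) * (P * fiboHoggatt d (suc (suc n)) (suc k))) ∎)
  where
  open ≡-Reasoning
  R : ℕ → ℕ → ℚ
  R k d = prodℚ d (λ j → F (ℤ.+ k ℤ.+ ℤ.+ suc j))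
  P = prodℚ d (λ i → F (ℤ.+ suc i))
  fk = F (ℤ.+ suc k)
  fd = F (ℤ.+ suc d)
  fn = F (ℤ.+ suc n)
  A  = fibonomialℕ (n ℕ.+ suc d) (suc d)
  A′ = fibonomialℕ (k ℕ.+ suc d) (suc d)
  C  = fibonomialℕ (suc n ℕ.+ d) d
  C′ = fibonomialℕ (k ℕ.+ d) d
  B = fibonomialℕ n k
  H = fiboHoggatt (suc d) n k
  G = fiboHoggatt d (suc n) k
  fd*A′ : ∀ k → fd * fibonomialℕ (k ℕ.+ suc d) (suc d) ≡ F (ℤ.+ k ℤ.+ ℤ.+ suc d) * fibonomialℕ (k ℕ.+ d) d
  fd*A′ k = subst (λ z → fd * fibonomialℕ z (suc d) ≡ F (ℤ.+ z) * fibonomialℕ (k ℕ.+ d) d)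
    (sym (ℕₚ.+-suc k d)) (fibonomialℕ-suc (k ℕ.+ d) d)
  difference : ∀ n d → 1ℤ ℤ.+ (n ℤ.+ d) ℤ.- d ≡ 1ℤ ℤ.+ n
  difference = ℤ-Solver.solve-∀
  -- The two absorption rules in turn lead from C(n+d+1, d+1) through C(n+d, d) to C(n+d+1, d).
  fd*A : fd * A ≡ fn * C
  fd*A = trans (fd*A′ n)
    (trans (cong (λ z → F (ℤ.+ z) * fibonomialℕ (n ℕ.+ d) d) (ℕₚ.+-suc n d))
    (trans (sym (fibonomialℕ-upper (n ℕ.+ d) d))
           (cong (λ z → F z * C) (difference (ℤ.+ n) (ℤ.+ d)))))
  -- Both sides are F_{k+1} ⋯ F_{k+d+1}.
  slide : ∀ d → fk * R (suc k) d ≡ R k d * F (ℤ.+ k ℤ.+ ℤ.+ suc d)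
  slide zero    = trans (*-comm fk 1ℚ) (cong (λ z → 1ℚ * F (ℤ.+ z)) (sym (ℕₚ.+-comm k 1)))
  slide (suc d) = trans (sym (*-assoc fk (R (suc k) d) (F (ℤ.+ suc k ℤ.+ ℤ.+ suc d))))
    (cong₂ (λ u z → u * F (ℤ.+ z)) (slide d) (sym (ℕₚ.+-suc k (suc d))))
  isolate : ∀ f c r a h → f * c * (r * (a * h)) ≡ f * r * c * a * h
  isolate = solve-∀ ring
  isolate′ : ∀ r f c a h → r * f * c * a * h ≡ f * c * a * (r * h)
  isolate′ = solve-∀ ring
  reassoc : ∀ f a′ a t → f * a′ * a * t ≡ f * (a * a′) * t
  reassoc = solve-∀ ring
  collect : ∀ f c c′ b p g → f * (c * c′) * (b * (p * g)) ≡ f * b * (c′ * (p * (c * g)))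
  collect = solve-∀ ring
  swap : ∀ f b c t → f * b * (c * t) ≡ f * c * (b * t)
  swap = solve-∀ ring

fiboHoggatt-zero : ∀ n k → fiboHoggatt 0 n k ≡ 1ℚ
fiboHoggatt-zero n zero    = refl
fiboHoggatt-zero n (suc k) = trans (*-identityʳ (fiboHoggatt 0 n k)) (fiboHoggatt-zero n k)

-- Induction on `d` from the empty determinant, for all `n` at once because the recurrences pass to
-- `n + 1`. The common factor F_{k+1} ⋯ F_{k+d} is positive and cancels.
det≡fiboHoggatt : ∀ d {n k} → k ≤ n → det d (fiboMatrix d n k) ≡ fiboHoggatt d n k
det≡fiboHoggatt zero    {n} {k} k≤n = sym (fiboHoggatt-zero n k)
det≡fiboHoggatt (suc d) {n} {k} k≤n =
  *-cancelˡ-pos (prodℚ d x) (prodℚ-positive d x λ j _ → subst (Positive ∘ F ∘ ℤ.+_) (sym (ℕₚ.+-suc k j)) (F-positive (k ℕ.+ j)))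
  (trans (det-fiboMatrix-rec d n k)
  (trans (cong (λ z → fibonomialℕ n k * (prodℚ d (λ i → F (ℤ.+ suc i)) * z)) (det≡fiboHoggatt d (ℕₚ.m≤n⇒m≤1+n k≤n)))
         (sym (fiboHoggatt-rec d k≤n))))
  where
  x : ℕ → ℚ
  x j = F (ℤ.+ k ℤ.+ ℤ.+ suc j)

fiboHoggatt-positive : ∀ d {n k} → k ≤ n → Positive (fiboHoggatt d n k)
fiboHoggatt-positive d {n} {zero}        _         = _
fiboHoggatt-positive d {suc n} {suc k} (s≤s k≤n) =
  subst Positive (sym (fiboHoggatt-suc d n k))
    (*-positive (c div c′) (fiboHoggatt d n k)
      (div-positive c c′ (fibonomialℕ-positive {n ℕ.+ d} {d} (ℕₚ.m≤n+m d n)) (fibonomialℕ-positive {k ℕ.+ d} {d} (ℕₚ.m≤n+m d k)))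
      (fiboHoggatt-positive d k≤n))
  where
  c  = fibonomialℕ (n ℕ.+ d) d
  c′ = fibonomialℕ (k ℕ.+ d) d

-- Integrality

Integral : ℚ → Set
Integral q = Σ ℤ λ z → q ≡ ℤtoℚ z

+-integral : ∀ {p q} → Integral p → Integral q → Integral (p + q)
+-integral (a , refl) (b , refl) = a ℤ.+ b , sym (ℤtoℚ-+ a b)

*-integral : ∀ {p q} → Integral p → Integral q → Integral (p * q)
*-integral (a , refl) (b , refl) = a ℤ.* b , sym (ℤtoℚ-* a b)

signPow-integral : ∀ t → Integral (signPow t)
signPow-integral t with ℤ.∣ t ∣ ℕ.% 2
... | zero  = 1ℤ , refl
... | suc _ = ℤ.- 1ℤ , refl

F-integral : ∀ z → Integral (F z)
F-integral (ℤ.+ n)  = ℤ.+ fib n , refl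
F-integral -[1+ n ] = *-integral (signPow-integral (ℤ.+ n)) (ℤ.+ fib (suc n) , refl)

-- Induction on `n` by the Pascal rule. For `m > n` its second coefficient is F_{n-m}, of negative
-- index, so integrality of `F` is used on all of ℤ.
fibonomial-integral : ∀ n m → Integral (fibonomial n m)
fibonomial-integral n       -[1+ k ]      = ℤ.+ 0 , refl
fibonomial-integral zero    (ℤ.+ zero)    = 1ℤ , refl
fibonomial-integral zero    (ℤ.+ (suc k)) = ℤ.+ 0 , refl
fibonomial-integral (suc n) m@(ℤ.+ _) =
  subst Integral pascal
    (+-integral (*-integral (F-integral (m ℤ.+ 1ℤ)) (fibonomial-integral n m))
                (*-integral (F-integral (ℤ.+ suc n ℤ.- (m ℤ.+ 1ℤ))) (fibonomial-integral n (ℤ.pred m))))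
  where
  rewriteSign : ∀ u b v c → u * b + v * c ≡ u * b - - 1ℚ * v * c
  rewriteSign = solve-∀ ring
  pascal : F (m ℤ.+ 1ℤ) * fibonomial n m + F (ℤ.+ suc n ℤ.- (m ℤ.+ 1ℤ)) * fibonomial n (ℤ.pred m) ≡ fibonomial (suc n) m
  pascal = trans (rewriteSign (F (m ℤ.+ 1ℤ)) (fibonomial n m) (F (ℤ.+ suc n ℤ.- (m ℤ.+ 1ℤ))) (fibonomial n (ℤ.pred m)))
    (trans (fibonomial-vajda n 1 m) (*-identityˡ (fibonomial (suc n) m)))

sumFin-integral : ∀ n {f} → (∀ j → Integral (f j)) → Integral (sumFin n f)
sumFin-integral zero    f∈ℤ = ℤ.+ 0 , refl
sumFin-integral (suc n) f∈ℤ = +-integral (f∈ℤ zero) (sumFin-integral n (f∈ℤ ∘ suc))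

det-integral : ∀ n {M} → (∀ i j → Integral (M i j)) → Integral (det n M)
det-integral zero    M∈ℤ = 1ℤ , refl
det-integral (suc n) M∈ℤ = sumFin-integral (suc n) λ j →
  *-integral (*-integral (signPow-integral (ℤ.+ toℕ j)) (M∈ℤ zero j)) (det-integral n λ r c → M∈ℤ (suc r) (punchIn j c))

positive-integral⇒ℕ : ∀ {q} → Positive q → Integral q → Σ ℕ λ m → (0 < m) × (q ≡ ℕtoℚ m)
positive-integral⇒ℕ ()  (ℤ.+ zero , refl)
positive-integral⇒ℕ q>0 (ℤ.+ suc m , eq) = suc m , s≤s z≤n , eq
positive-integral⇒ℕ q>0 (-[1+ n ] , refl) = ⊥-elim (positive⇒≢0
  (pos+pos⇒pos (ℤtoℚ -[1+ n ]) {{q>0}} (ℕtoℚ (suc n)) {{ℕtoℚ-positive {suc n} (s≤s z≤n)}})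
  (trans (sym (ℤtoℚ-+ -[1+ n ] (ℤ.+ suc n))) (cong ℤtoℚ (ℤₚ.+-inverseˡ (ℤ.+ suc n)))))

theorem12 : (d n k : ℕ) → 1 ≤ d → k ≤ n →
    (det d (fiboMatrix d n k) ≡ fiboHoggatt d n k)
    × Σ ℕ (λ m → (0 < m) × (fiboHoggatt d n k ≡ ℕtoℚ m))
theorem12 d n k _ k≤n =
  det≡fiboHoggatt d k≤n ,
  positive-integral⇒ℕ (fiboHoggatt-positive d k≤n)
    -- The Hoggatt number is a product of quotients; its integrality is read off the determinant,
    -- whose entries are integers.
    (subst Integral (det≡fiboHoggatt d k≤n) (det-integral d λ i j →
      *-integral (signPow-integral (choose2 (ℤ.+ toℕ i ℤ.- ℤ.+ toℕ j)))
                 (fibonomial-integral n (ℤ.+ k ℤ.- ℤ.+ toℕ i ℤ.+ ℤ.+ toℕ j))))
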